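{- Let $v:\tau$ be a term of $\mathcal T_{class}$ whose free variables are among $x_1^{\sigma_1},\dots,x_n^{\sigma_n}$. If $t_1\in\mathrm{Comp}_{\sigma_1},\dots,t_n\in\mathrm{Comp}_{\sigma_n}$, then $v[t_1/x_1,\dots,t_n/x_n]\in\mathrm{Comp}_\tau$.
   Context: Updates: an update is a finite set of triples of natural numbers forming the graph of a partial function $\mathbb N^2\to\mathbb N$. System $\mathcal T$ is Gödel's System T (types $\mathsf N,\mathsf{Bool}$, $\sigma\to\tau$, $\sigma\times\tau$; pairs, projections $\pi_0,\pi_1$; constants $0,\mathsf S,\mathsf{True},\mathsf{False},\mathsf{if}_\tau,\mathsf{rec}_\tau$) extended with a base type $\mathsf U$ of updates, a constant $\overline U$ for each update, and constants $\min:\mathsf U\to\mathsf N$, $\mathsf{get}:\mathsf U\to\mathsf N\to\mathsf N\to\mathsf N\to\mathsf N$, $\mathsf{mkupd}:\mathsf N\to\mathsf N\to\mathsf N\to\mathsf U$, $\cup:\mathsf U\to\mathsf U\to\mathsf U$ with reductions: $\min\overline U$ gives the least $a$ with $(a,n,m)\in U$ (0 if $U=\emptyset$); $\mathsf{get}\,\overline U\,a\,n\,l$ gives $m$ if $(a,n,m)\in U$, else $l$; $\mathsf{mkupd}\,a\,n\,m$ gives $\overline{\{(a,n,m)\}}$; $\overline{U_1}\cup\overline{U_2}$ gives the consistent union ($U_1\cup U_2$ minus triples of $U_2$ inconsistent with some triple of $U_1$). Terms of $\mathcal T$ are strongly normalizing with unique normal forms; $t_1=t_2$ means same normal form; closed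 normal terms of type $\mathsf N,\mathsf{Bool},\mathsf U$ are numerals, booleans, update constants. $\mathcal T_{class}$ is $\mathcal T$ plus countably many constants $\Phi_0,\Phi_1,\dots:\mathsf N\to\mathsf N$ without reduction rules. A state is a closed term $s:\mathsf N\to\mathsf N\to\mathsf N$ of $\mathcal T$; $s_i:=s(i)$; $t[s]$ replaces each $\Phi_i$ in $t$ by $s_i$. Each arithmetical formula $A(\vec x,y)$ (no $\Phi_i$, quantifiers over $\mathsf N$, atoms boolean terms of $\mathcal T$) is associated with exactly one constant $\Phi_A$ (distinct formulas, distinct constants); $\langle\vec x\rangle$ is a term of $\mathcal T$ coding an injection $\mathbb N^k\to\mathbb N$, bijective on numerals. $\Gamma$ is a fixed arbitrary finite set of arithmetical formulas. $\mathrm{dm}(s)$ is the set of pairs $(i,\langle\vec n\rangle)$ such that $\Phi_i=\Phi_A$ and (if $A\in\Gamma$ then $\exists y\,A(\vec n,y)\to A(\vec n,s_i\langle\vec n\rangle)$ is true). $s'\geq s$ iff for all $(i,\langle\vec n\rangle)\in\mathrm{dm}(s)$, $s_i\langle\vec n\rangle=s'_i\langle\vec n\rangle$. For a term $t$ of $\mathcal T_{class}$ of atomic type, $t$ is defined in $s$ if $t[s']=t[s]$ for all states $s'\geq s$. Computable terms: for $\tau\in\{\mathsf N,\mathsf{Bool},\mathsf U\}$, $\mathrm{Comp}_\tau$ is the set of closed $t:\tau$ of $\mathcal T_{class}$ such that for every state $s$ there is a state $s'\geq s$ with $t$ defined in $s'$; $\mathrm{Comp}_{\tau\to\sigma}=\{t: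 tu\in\mathrm{Comp}_\sigma \text{ for all } u\in\mathrm{Comp}_\tau\}$; $\mathrm{Comp}_{\tau\times\sigma}=\{t:\pi_0t\in\mathrm{Comp}_\tau,\ \pi_1t\in\mathrm{Comp}_\sigma\}$.
   Formalization: The association of formulas with constants is assumed onto: every Φ_i is Φ_A for some A (otherwise an unassociated Φ_i makes Φ_i 0 defined in no state); the tuple x has length at least 1, as a coding bijective on numerals requires. -}

module Defs where

open import Data.Empty using (⊥)
open import Data.List.Base using (List; []; _∷_; [_]; map; foldr; replicate)
open import Data.List.Extrema.Nat using (min)
open import Data.List.Membership.Propositional using (_∈_)
open import Data.List.Relation.Unary.All as All using (All; []; _∷_)
open import Data.List.Relation.Unary.AllPairs using (AllPairs; []; _∷_; allPairs?)
open import Data.List.Relation.Unary.Any using (here; there)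
open import Data.Nat.Base using (ℕ; zero; suc; _<_)
open import Data.Nat.Properties using (_≟_; <-cmp; <-trans; <-irrefl; <-resp₂-≡)
open import Data.Product.Base using (_×_; _,_; proj₁; proj₂; ∃; ∃-syntax; Σ-syntax)
open import Data.Product.Relation.Binary.Lex.Strict
  using (×-Lex; ×-compare; ×-transitive; ×-irreflexive)
open import Data.Sum.Base using (_⊎_; inj₁; inj₂)
open import Data.Vec.Base as Vec using (Vec; []; _∷_)
open import Function.Bundles using (_⤖_; _⇔_; mk⇔; module Bijection)
open import Relation.Binary.Construct.Closure.ReflexiveTransitive using (Star)
open import Relation.Binary.Definitions using (Tri; tri<; tri≈; tri>; Decidable)
open import Relation.Binary.PropositionalEquality
  using (_≡_; refl; sym; cong; isEquivalence)
open import Relation.Binary.Rewriting using (IsNormalForm)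
open import Relation.Nullary using (¬_; yes; no; contradiction)
open import Relation.Nullary.Decidable using (recompute)

------------------------------------------------------------------------
-- Updates

Triple : Set
Triple = ℕ × ℕ × ℕ

key : Triple → ℕ × ℕ
key (a , n , _) = a , n

val : Triple → ℕ
val (_ , _ , m) = m

_≺_ : Triple → Triple → Set
t ≺ u = ×-Lex _≡_ _<_ _<_ (key t) (key u)

-- A finite set of triples is represented canonically, by the list of its
-- elements with strictly increasing keys (a , n).  Strictness makes the set
-- the graph of a partial function ℕ² → ℕ, and canonicity together with the
-- irrelevance of `sorted` makes equality of updates coincide with `_≡_`.
record Update : Set where
  constructor mkUpdate
  field
    triples : List Triple
    .sorted : AllPairs _≺_ triples
open Update public

minimum : Update → ℕ
minimum (mkUpdate []            _) = 0
minimum (mkUpdate ((a , _) ∷ ts) _) = min a (map proj₁ ts)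

lookupOr : ℕ → List Triple → ℕ → ℕ → ℕ
lookupOr l []                   a n = l
lookupOr l ((a′ , n′ , m) ∷ ts) a n with a ≟ a′ | n ≟ n′
... | yes _ | yes _ = m
... | _     | _     = lookupOr l ts a n

getU : Update → ℕ → ℕ → ℕ → ℕ
getU U a n l = lookupOr l (triples U) a n

singleton : ℕ → ℕ → ℕ → Update
singleton a n m = mkUpdate [ (a , n , m) ] ([] ∷ [])

≺-trans : ∀ {t u v} → t ≺ u → u ≺ v → t ≺ v
≺-trans {t} {u} {v} =
  ×-transitive {_<₁_ = _<_} {_<₂_ = _<_} isEquivalence <-resp₂-≡ <-trans <-trans
    {key t} {key u} {key v}

≺-compare : ∀ t u → Tri (t ≺ u) (proj₁ t ≡ proj₁ u × proj₁ (proj₂ t) ≡ proj₁ (proj₂ u)) (u ≺ t)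
≺-compare t u = ×-compare sym <-cmp <-cmp (key t) (key u)

-- An already present triple with the same key takes precedence.
insert : Triple → List Triple → List Triple
insert t []       = [ t ]
insert t (u ∷ us) with ≺-compare t u
... | tri< _ _ _ = t ∷ u ∷ us
... | tri≈ _ _ _ = u ∷ us
... | tri> _ _ _ = u ∷ insert t us

insert-All : ∀ {P : Triple → Set} t {us} → P t → All P us → All P (insert t us)
insert-All t           pt []         = pt ∷ []
insert-All t {u ∷ us}  pt (pu ∷ pus) with ≺-compare t u
... | tri< _ _ _ = pt ∷ pu ∷ pus
... | tri≈ _ _ _ = pu ∷ pus
... | tri> _ _ _ = pu ∷ insert-All t pt pus

insert-sorted : ∀ t {us} → AllPairs _≺_ us → AllPairs _≺_ (insert t us)
insert-sorted t          []         = [] ∷ []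
insert-sorted t {u ∷ us} (u≺ ∷ us↗) with ≺-compare t u
... | tri< t≺u _ _ =
  (t≺u ∷ All.map (λ {v} → ≺-trans {t} {u} {v} t≺u) u≺) ∷ u≺ ∷ us↗
... | tri≈ _ _ _   = u≺ ∷ us↗
... | tri> _ _ u≺t = insert-All t u≺t u≺ ∷ insert-sorted t us↗

insertAll : List Triple → List Triple → List Triple
insertAll us vs = foldr insert us vs

insertAll-sorted : ∀ {us} vs → AllPairs _≺_ us → AllPairs _≺_ (insertAll us vs)
insertAll-sorted []       us↗ = us↗
insertAll-sorted (v ∷ vs) us↗ = insert-sorted v (insertAll-sorted vs us↗)

_∪_ : Update → Update → Update
mkUpdate us us↗ ∪ mkUpdate vs _ = mkUpdate (insertAll us vs) (insertAll-sorted vs us↗)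

-- `∪-spec` below: U ∪ V is the set-theoretic union minus the triples of V
-- that are inconsistent with some triple of U.

Consistent : Triple → Triple → Set
Consistent t u = key t ≡ key u → val t ≡ val u

insert-⊇ : ∀ t {us x} → x ∈ us → x ∈ insert t us
insert-⊇ t {u ∷ us} x∈ with ≺-compare t u
... | tri< _ _ _ = there x∈
... | tri≈ _ _ _ = x∈
insert-⊇ t {u ∷ us} (here eq)  | tri> _ _ _ = here eq
insert-⊇ t {u ∷ us} (there x∈) | tri> _ _ _ = there (insert-⊇ t x∈)

insert-∈ : ∀ t {us} → (∀ {u} → u ∈ us → Consistent t u) → t ∈ insert t us
insert-∈ t {[]}     _ = here refl
insert-∈ t {u ∷ us} c with ≺-compare t u
... | tri< _ _ _             = here refl
insert-∈ (a , n , m) {(.a , .n , m′) ∷ us} c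
    | tri≈ _ (refl , refl) _ = here (cong (λ k → a , n , k) (c (here refl) refl))
insert-∈ t {u ∷ us} c
    | tri> _ _ _             = there (insert-∈ t (λ u∈ → c (there u∈)))

≺⇒key≢ : ∀ {t u} → t ≺ u → ¬ key t ≡ key u
≺⇒key≢ t≺u refl = ×-irreflexive {_<₁_ = _<_} {_<₂_ = _<_} <-irrefl <-irrefl (refl , refl) t≺u

insert-⊆ : ∀ t {us x} → AllPairs _≺_ us → x ∈ insert t us →
           x ∈ us ⊎ (x ≡ t × (∀ {u} → u ∈ us → ¬ key t ≡ key u))
insert-⊆ t {[]} _ (here refl) = inj₂ (refl , λ ())
insert-⊆ t {u ∷ us} (u≺ ∷ _) x∈ with ≺-compare t u
insert-⊆ t {u ∷ us} (u≺ ∷ _) (here refl) | tri< t≺u _ _ = inj₂ (refl , λ where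
  (here refl)    → ≺⇒key≢ {t} {u} t≺u
  {v} (there v∈) → ≺⇒key≢ {t} {v} (≺-trans {t} {u} {v} t≺u (All.lookup u≺ v∈)))
insert-⊆ t (u≺ ∷ _) (there x∈)   | tri< _ _ _ = inj₁ x∈
insert-⊆ t (u≺ ∷ _) x∈           | tri≈ _ _ _ = inj₁ x∈
insert-⊆ t (u≺ ∷ _) (here eq)    | tri> _ _ _ = inj₁ (here eq)
insert-⊆ t {u ∷ us} (u≺ ∷ us↗) (there x∈) | tri> _ _ u≺t with insert-⊆ t us↗ x∈
... | inj₁ x∈us         = inj₁ (there x∈us)
... | inj₂ (refl , t∉us) = inj₂ (refl , λ where
  (here refl) eq → ≺⇒key≢ {u} {t} u≺t (sym eq)
  (there v∈)  eq → t∉us v∈ eq)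

insertAll-⊇ : ∀ {us} vs {x} → x ∈ us → x ∈ insertAll us vs
insertAll-⊇ []       x∈ = x∈
insertAll-⊇ (v ∷ vs) x∈ = insert-⊇ v (insertAll-⊇ vs x∈)

insertAll-⊆ : ∀ {us} vs {x} → AllPairs _≺_ us → x ∈ insertAll us vs →
              x ∈ us ⊎ (x ∈ vs × (∀ {u} → u ∈ us → Consistent x u))
insertAll-⊆ []       us↗ x∈ = inj₁ x∈
insertAll-⊆ (v ∷ vs) us↗ x∈ with insert-⊆ v (insertAll-sorted vs us↗) x∈
... | inj₂ (refl , v∉) =
  inj₂ (here refl , λ u∈ eq → contradiction eq (v∉ (insertAll-⊇ vs u∈)))
... | inj₁ x∈′ with insertAll-⊆ vs us↗ x∈′
...   | inj₁ x∈us       = inj₁ x∈us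
...   | inj₂ (x∈vs , c) = inj₂ (there x∈vs , c)

insertAll-∈ : ∀ {us} vs {x} → AllPairs _≺_ us → AllPairs _≺_ vs →
              x ∈ vs → (∀ {u} → u ∈ us → Consistent x u) → x ∈ insertAll us vs
insertAll-∈ {us} (v ∷ vs) us↗ (v≺ ∷ vs↗) (here refl) c = insert-∈ v c′
  where
  c′ : ∀ {u} → u ∈ insertAll us vs → Consistent v u
  c′ {u} u∈ with insertAll-⊆ vs us↗ u∈
  ... | inj₁ u∈us       = c u∈us
  ... | inj₂ (u∈vs , _) = λ eq → contradiction eq (≺⇒key≢ {v} {u} (All.lookup v≺ u∈vs))
insertAll-∈ (v ∷ vs) us↗ (v≺ ∷ vs↗) (there x∈) c = insert-⊇ v (insertAll-∈ vs us↗ vs↗ x∈ c)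

_≺?_ : Decidable _≺_
t ≺? u with ≺-compare t u
... | tri< p _ _ = yes p
... | tri≈ p _ _ = no p
... | tri> p _ _ = no p

∪-spec : ∀ U V {x} →
  x ∈ triples (U ∪ V) ⇔
  (x ∈ triples U ⊎ (x ∈ triples V × (∀ {u} → u ∈ triples U → Consistent x u)))
∪-spec (mkUpdate us us↗) (mkUpdate vs vs↗) = mk⇔
  (insertAll-⊆ vs us↗′)
  (λ { (inj₁ x∈us)       → insertAll-⊇ vs x∈us
     ; (inj₂ (x∈vs , c)) → insertAll-∈ vs us↗′ vs↗′ x∈vs c })
  where
  us↗′ : AllPairs _≺_ us
  us↗′ = recompute (allPairs? _≺?_ us) us↗
  vs↗′ : AllPairs _≺_ vs
  vs↗′ = recompute (allPairs? _≺?_ vs) vs↗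

------------------------------------------------------------------------
-- Terms

infixr 7 _⇒_
infixr 8 _⊗_

data Ty : Set where
  N Bool U : Ty
  _⇒_ _⊗_  : Ty → Ty → Ty

Ctx : Set
Ctx = List Ty

data Const : Ty → Set where
  zeroᶜ            : Const N
  sucᶜ             : Const (N ⇒ N)
  trueᶜ falseᶜ     : Const Bool
  ifᶜ              : ∀ τ → Const (Bool ⇒ τ ⇒ τ ⇒ τ)
  recᶜ             : ∀ τ → Const (τ ⇒ (N ⇒ τ ⇒ τ) ⇒ N ⇒ τ)
  updᶜ             : Update → Const U
  minᶜ             : Const (U ⇒ N)
  getᶜ             : Const (U ⇒ N ⇒ N ⇒ N ⇒ N)
  mkupdᶜ           : Const (N ⇒ N ⇒ N ⇒ U)
  ∪ᶜ               : Const (U ⇒ U ⇒ U)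

infixl 9 _·_

-- K indexes additional constants N ⇒ N without reduction rules.
data Tm (K : Set) (Γ : Ctx) : Ty → Set where
  var   : ∀ {τ} → τ ∈ Γ → Tm K Γ τ
  con   : ∀ {τ} → Const τ → Tm K Γ τ
  Φ     : K → Tm K Γ (N ⇒ N)
  ƛ     : ∀ {σ τ} → Tm K (σ ∷ Γ) τ → Tm K Γ (σ ⇒ τ)
  _·_   : ∀ {σ τ} → Tm K Γ (σ ⇒ τ) → Tm K Γ σ → Tm K Γ τ
  pair  : ∀ {σ τ} → Tm K Γ σ → Tm K Γ τ → Tm K Γ (σ ⊗ τ)
  π₀    : ∀ {σ τ} → Tm K Γ (σ ⊗ τ) → Tm K Γ σ
  π₁    : ∀ {σ τ} → Tm K Γ (σ ⊗ τ) → Tm K Γ τ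

𝒯 : Ctx → Ty → Set
𝒯 = Tm ⊥

𝒯class : Ctx → Ty → Set
𝒯class = Tm ℕ

numeral : ∀ {K Γ} → ℕ → Tm K Γ N
numeral zero    = con zeroᶜ
numeral (suc n) = con sucᶜ · numeral n

Ren : Ctx → Ctx → Set
Ren Γ Δ = ∀ {τ} → τ ∈ Γ → τ ∈ Δ

ext : ∀ {Γ Δ σ} → Ren Γ Δ → Ren (σ ∷ Γ) (σ ∷ Δ)
ext ρ (here eq) = here eq
ext ρ (there x) = there (ρ x)

rename : ∀ {K Γ Δ τ} → Ren Γ Δ → Tm K Γ τ → Tm K Δ τ
rename ρ (var x)    = var (ρ x)
rename ρ (con c)    = con c
rename ρ (Φ i)      = Φ i
rename ρ (ƛ t)      = ƛ (rename (ext ρ) t)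
rename ρ (t · u)    = rename ρ t · rename ρ u
rename ρ (pair t u) = pair (rename ρ t) (rename ρ u)
rename ρ (π₀ t)     = π₀ (rename ρ t)
rename ρ (π₁ t)     = π₁ (rename ρ t)

Sub : Set → Ctx → Ctx → Set
Sub K Γ Δ = ∀ {τ} → τ ∈ Γ → Tm K Δ τ

exts : ∀ {K Γ Δ σ} → Sub K Γ Δ → Sub K (σ ∷ Γ) (σ ∷ Δ)
exts θ (here eq) = var (here eq)
exts θ (there x) = rename there (θ x)

subst : ∀ {K Γ Δ τ} → Sub K Γ Δ → Tm K Γ τ → Tm K Δ τ
subst θ (var x)    = θ x
subst θ (con c)    = con c
subst θ (Φ i)      = Φ i
subst θ (ƛ t)      = ƛ (subst (exts θ) t)
subst θ (t · u)    = subst θ t · subst θ u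
subst θ (pair t u) = pair (subst θ t) (subst θ u)
subst θ (π₀ t)     = π₀ (subst θ t)
subst θ (π₁ t)     = π₁ (subst θ t)

single : ∀ {K Γ σ} → Tm K Γ σ → Sub K (σ ∷ Γ) Γ
single u (here refl) = u
single u (there x)   = var x

_[_]₀ : ∀ {K Γ σ τ} → Tm K (σ ∷ Γ) τ → Tm K Γ σ → Tm K Γ τ
t [ u ]₀ = subst (single u) t

------------------------------------------------------------------------
-- Reduction and equality

infix 4 _⟶_ _⟶*_ _≈_

data _⟶_ {K Γ} : ∀ {τ} → Tm K Γ τ → Tm K Γ τ → Set where
  β        : ∀ {σ τ} (t : Tm K (σ ∷ Γ) τ) u → ƛ t · u ⟶ t [ u ]₀
  β-π₀     : ∀ {σ τ} (t : Tm K Γ σ) (u : Tm K Γ τ) → π₀ (pair t u) ⟶ t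
  β-π₁     : ∀ {σ τ} (t : Tm K Γ σ) (u : Tm K Γ τ) → π₁ (pair t u) ⟶ u
  if-true  : ∀ {τ} (t u : Tm K Γ τ) → con (ifᶜ τ) · con trueᶜ  · t · u ⟶ t
  if-false : ∀ {τ} (t u : Tm K Γ τ) → con (ifᶜ τ) · con falseᶜ · t · u ⟶ u
  rec-zero : ∀ {τ} (u : Tm K Γ τ) v → con (recᶜ τ) · u · v · con zeroᶜ ⟶ u
  rec-suc  : ∀ {τ} (u : Tm K Γ τ) v t →
             con (recᶜ τ) · u · v · (con sucᶜ · t) ⟶ v · t · (con (recᶜ τ) · u · v · t)
  δ-min    : ∀ V → con minᶜ · con (updᶜ V) ⟶ numeral (minimum V)
  δ-get    : ∀ V a n l →
             con getᶜ · con (updᶜ V) · numeral a · numeral n · numeral l ⟶ numeral (getU V a n l)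
  δ-mkupd  : ∀ a n m →
             con mkupdᶜ · numeral a · numeral n · numeral m ⟶ con (updᶜ (singleton a n m))
  δ-∪      : ∀ V W → con ∪ᶜ · con (updᶜ V) · con (updᶜ W) ⟶ con (updᶜ (V ∪ W))
  ξ-ƛ      : ∀ {σ τ} {t t′ : Tm K (σ ∷ Γ) τ} → t ⟶ t′ → ƛ t ⟶ ƛ t′
  ξ-·ˡ     : ∀ {σ τ} {t t′ : Tm K Γ (σ ⇒ τ)} {u} → t ⟶ t′ → t · u ⟶ t′ · u
  ξ-·ʳ     : ∀ {σ τ} {t : Tm K Γ (σ ⇒ τ)} {u u′} → u ⟶ u′ → t · u ⟶ t · u′
  ξ-pairˡ  : ∀ {σ τ} {t t′ : Tm K Γ σ} {u : Tm K Γ τ} → t ⟶ t′ → pair t u ⟶ pair t′ u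
  ξ-pairʳ  : ∀ {σ τ} {t : Tm K Γ σ} {u u′ : Tm K Γ τ} → u ⟶ u′ → pair t u ⟶ pair t u′
  ξ-π₀     : ∀ {σ τ} {t t′ : Tm K Γ (σ ⊗ τ)} → t ⟶ t′ → π₀ t ⟶ π₀ t′
  ξ-π₁     : ∀ {σ τ} {t t′ : Tm K Γ (σ ⊗ τ)} → t ⟶ t′ → π₁ t ⟶ π₁ t′

_⟶*_ : ∀ {K Γ τ} → Tm K Γ τ → Tm K Γ τ → Set
_⟶*_ = Star _⟶_

_≈_ : ∀ {K Γ τ} → Tm K Γ τ → Tm K Γ τ → Set
t ≈ u = ∃[ w ] IsNormalForm _⟶_ w × t ⟶* w × u ⟶* w

------------------------------------------------------------------------
-- States

State : Set
State = 𝒯 [] (N ⇒ N ⇒ N)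

_at_ : State → ℕ → 𝒯 [] (N ⇒ N)
s at i = s · numeral i

_[_]ˢ : ∀ {Γ τ} → 𝒯class Γ τ → State → 𝒯 Γ τ
var x    [ s ]ˢ = var x
con c    [ s ]ˢ = con c
Φ i      [ s ]ˢ = rename (λ ()) (s at i)
ƛ t      [ s ]ˢ = ƛ (t [ s ]ˢ)
(t · u)  [ s ]ˢ = (t [ s ]ˢ) · (u [ s ]ˢ)
pair t u [ s ]ˢ = pair (t [ s ]ˢ) (u [ s ]ˢ)
π₀ t     [ s ]ˢ = π₀ (t [ s ]ˢ)
π₁ t     [ s ]ˢ = π₁ (t [ s ]ˢ)

------------------------------------------------------------------------
-- Arithmetical formulas

Nats : ℕ → Ctx
Nats k = replicate k N

closing : ∀ {k} → Vec (𝒯 [] N) k → Sub ⊥ (Nats k) []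
closing (t ∷ ts) (here refl) = t
closing (t ∷ ts) (there x)   = closing ts x

infixr 6 _∧ᶠ_
infixr 5 _∨ᶠ_
infixr 4 _→ᶠ_

-- Formulas with k free variables of type N, in de Bruijn style.
data Formula (k : ℕ) : Set where
  atom           : 𝒯 (Nats k) Bool → Formula k
  _∧ᶠ_ _∨ᶠ_ _→ᶠ_ : Formula k → Formula k → Formula k
  ∀ᶠ ∃ᶠ          : Formula (suc k) → Formula k

-- Truth of the closed instance of a formula by closed terms.
True : ∀ {k} → Formula k → Vec (𝒯 [] N) k → Set
True (atom t) ts = subst (closing ts) t ≈ con trueᶜ
True (A ∧ᶠ B) ts = True A ts × True B ts
True (A ∨ᶠ B) ts = True A ts ⊎ True B ts
True (A →ᶠ B) ts = True A ts → True B ts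
True (∀ᶠ A)   ts = ∀ n → True A (numeral n ∷ ts)
True (∃ᶠ A)   ts = ∃[ n ] True A (numeral n ∷ ts)

-- A formula A(x⃗ , y): the index 0 is y, and the tuple x⃗ has length suc extra.
-- It is nonempty because a coding ℕᵏ → ℕ can be bijective only for k ≥ 1.
record ArithFormula : Set where
  constructor formula
  field
    {extra} : ℕ
    body    : Formula (suc (suc extra))
open ArithFormula public

numerals : ∀ {k} → Vec ℕ k → Vec (𝒯 [] N) k
numerals = Vec.map numeral

Holds : (A : ArithFormula) → Vec ℕ (suc (extra A)) → 𝒯 [] N → Set
Holds A ns t = True (body A) (t ∷ numerals ns)

record Coding : Set where
  field
    tuple : ∀ k → 𝒯 (Nats (suc k)) N

  ⟨_⟩ : ∀ {k} → Vec ℕ (suc k) → 𝒯 [] N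
  ⟨ ns ⟩ = subst (closing (numerals ns)) (tuple _)

  field
    injective  : ∀ {k} (ms ns : Vec ℕ (suc k)) → ⟨ ms ⟩ ≈ ⟨ ns ⟩ → ms ≡ ns
    surjective : ∀ {k} m → Σ[ ns ∈ Vec ℕ (suc k) ] ⟨ ns ⟩ ≈ numeral m

------------------------------------------------------------------------
-- Computable terms

module Computability
  -- Φ i is the constant Φ_A exactly when `Bijection.to assoc A ≡ i`; by
  -- surjectivity, every constant of 𝒯class is associated with a formula.
  (assoc : ArithFormula ⤖ ℕ)
  (coding : Coding)
  (Γ : List ArithFormula)
  where

  open Coding coding using (⟨_⟩)

  index : ArithFormula → ℕ
  index = Bijection.to assoc

  dm : State → ℕ × 𝒯 [] N → Set
  dm s (i , u) =
    Σ[ A ∈ ArithFormula ] Σ[ ns ∈ Vec ℕ (suc (extra A)) ]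
      i ≡ index A × u ≡ ⟨ ns ⟩ ×
      (A ∈ Γ → (∃[ y ] Holds A ns (numeral y)) → Holds A ns (s at i · ⟨ ns ⟩))

  infix 4 _≽_

  _≽_ : State → State → Set
  s′ ≽ s = ∀ {i u} → dm s (i , u) → s at i · u ≈ s′ at i · u

  DefinedIn : ∀ {τ} → 𝒯class [] τ → State → Set
  DefinedIn t s = ∀ s′ → s′ ≽ s → t [ s′ ]ˢ ≈ t [ s ]ˢ

  DenselyDefined : ∀ {τ} → 𝒯class [] τ → Set
  DenselyDefined t = ∀ s → ∃[ s′ ] (s′ ≽ s × DefinedIn t s′)

  Comp : ∀ τ → 𝒯class [] τ → Set
  Comp N       t = DenselyDefined t
  Comp Bool    t = DenselyDefined t
  Comp U       t = DenselyDefined t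
  Comp (τ ⇒ σ) t = ∀ u → Comp τ u → Comp σ (t · u)
  Comp (τ ⊗ σ) t = Comp τ (π₀ t) × Comp σ (π₁ t)

{-# OPTIONS --safe #-}

-- Closed terms of 𝒯 are interpreted in the full set-theoretic type structure.
-- Reduction preserves values, and a closed term of atomic type reduces to the
-- canonical term of its value; hence _≈_ on closed atomic terms is equality of
-- values, and definedness and the order on states can be handled semantically.
--
-- The key to the theorem is that computability is local: t is computable as
-- soon as every state has an extension from which on t agrees with some
-- computable term.  An argument of atomic type may therefore be replaced by a
-- canonical one, which disposes of all constants.  For Φ_A at ⟨n⃗⟩, a state is
-- either already right about A and n⃗, or can be overridden at this one point
-- with a witness, without changing any value on its domain.
module Submission where

open import Level using (0ℓ)
open import Axiom.ExcludedMiddle using (ExcludedMiddle)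
open import Data.Bool.Base as Bool using (true; false; if_then_else_)
open import Data.Empty using (⊥)
open import Data.List.Base using (List; []; _∷_)
open import Data.List.Membership.Propositional using (_∈_)
open import Data.List.Relation.Unary.Any using (here; there)
open import Data.Nat.Base using (ℕ; zero; suc)
open import Data.Nat.Properties using (_≟_)
open import Data.Product.Base using (_×_; _,_; proj₁; proj₂; ∃-syntax)
open import Data.Sum.Base as Sum using ()
open import Data.Vec.Base using (Vec; []; _∷_)
open import Function.Base using (_∘_)
open import Function.Bundles using (_⤖_; module Bijection)
open import Relation.Binary.Construct.Closure.ReflexiveTransitive
  using (ε; _◅_; _◅◅_; gmap)
open import Relation.Binary.PropositionalEquality
  using (_≡_; refl; sym; trans; cong; cong₂; module ≡-Reasoning)
  renaming (subst to transport)
open import Relation.Binary.Rewriting using (IsNormalForm)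
open import Relation.Nullary using (yes; no; contradiction)
open import Defs

private
  variable
    K : Set
    Γ Δ Θ : Ctx
    σ τ : Ty

-- Substitution

ext-∘ : (ρ : Ren Γ Δ) (ρ′ : Ren Δ Θ) (x : τ ∈ σ ∷ Γ) →
        ext ρ′ (ext ρ x) ≡ ext (ρ′ ∘ ρ) x
ext-∘ ρ ρ′ (here _)  = refl
ext-∘ ρ ρ′ (there x) = refl

rename-cong : {ρ ρ′ : Ren Γ Δ} → (∀ {τ} (x : τ ∈ Γ) → ρ x ≡ ρ′ x) →
              (t : Tm K Γ τ) → rename ρ t ≡ rename ρ′ t
rename-cong e (var x)    = cong var (e x)
rename-cong e (con c)    = refl
rename-cong e (Φ i)      = refl
rename-cong e (ƛ t)      =
  cong ƛ (rename-cong (λ { (here _) → refl ; (there x) → cong there (e x) }) t)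
rename-cong e (t · u)    = cong₂ _·_ (rename-cong e t) (rename-cong e u)
rename-cong e (pair t u) = cong₂ pair (rename-cong e t) (rename-cong e u)
rename-cong e (π₀ t)     = cong π₀ (rename-cong e t)
rename-cong e (π₁ t)     = cong π₁ (rename-cong e t)

subst-cong : {θ θ′ : Sub K Γ Δ} → (∀ {τ} (x : τ ∈ Γ) → θ x ≡ θ′ x) →
             (t : Tm K Γ τ) → subst θ t ≡ subst θ′ t
subst-cong e (var x)    = e x
subst-cong e (con c)    = refl
subst-cong e (Φ i)      = refl
subst-cong e (ƛ t)      =
  cong ƛ (subst-cong (λ { (here _) → refl ; (there x) → cong (rename there) (e x) }) t)
subst-cong e (t · u)    = cong₂ _·_ (subst-cong e t) (subst-cong e u)
subst-cong e (pair t u) = cong₂ pair (subst-cong e t) (subst-cong e u)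
subst-cong e (π₀ t)     = cong π₀ (subst-cong e t)
subst-cong e (π₁ t)     = cong π₁ (subst-cong e t)

rename-rename : (ρ : Ren Γ Δ) (ρ′ : Ren Δ Θ) (t : Tm K Γ τ) →
                rename ρ′ (rename ρ t) ≡ rename (ρ′ ∘ ρ) t
rename-rename ρ ρ′ (var x)    = refl
rename-rename ρ ρ′ (con c)    = refl
rename-rename ρ ρ′ (Φ i)      = refl
rename-rename ρ ρ′ (ƛ t)      =
  cong ƛ (trans (rename-rename (ext ρ) (ext ρ′) t) (rename-cong (ext-∘ ρ ρ′) t))
rename-rename ρ ρ′ (t · u)    = cong₂ _·_ (rename-rename ρ ρ′ t) (rename-rename ρ ρ′ u)
rename-rename ρ ρ′ (pair t u) = cong₂ pair (rename-rename ρ ρ′ t) (rename-rename ρ ρ′ u)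
rename-rename ρ ρ′ (π₀ t)     = cong π₀ (rename-rename ρ ρ′ t)
rename-rename ρ ρ′ (π₁ t)     = cong π₁ (rename-rename ρ ρ′ t)

subst-rename : (ρ : Ren Γ Δ) (θ : Sub K Δ Θ) (t : Tm K Γ τ) →
               subst θ (rename ρ t) ≡ subst (θ ∘ ρ) t
subst-rename ρ θ (var x)    = refl
subst-rename ρ θ (con c)    = refl
subst-rename ρ θ (Φ i)      = refl
subst-rename ρ θ (ƛ t)      =
  cong ƛ (trans (subst-rename (ext ρ) (exts θ) t)
                (subst-cong (λ { (here _) → refl ; (there x) → refl }) t))
subst-rename ρ θ (t · u)    = cong₂ _·_ (subst-rename ρ θ t) (subst-rename ρ θ u)
subst-rename ρ θ (pair t u) = cong₂ pair (subst-rename ρ θ t) (subst-rename ρ θ u)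
subst-rename ρ θ (π₀ t)     = cong π₀ (subst-rename ρ θ t)
subst-rename ρ θ (π₁ t)     = cong π₁ (subst-rename ρ θ t)

rename-exts : (θ : Sub K Γ Δ) (ρ : Ren Δ Θ) (x : τ ∈ σ ∷ Γ) →
              rename (ext ρ) (exts θ x) ≡ exts (rename ρ ∘ θ) x
rename-exts θ ρ (here _)  = refl
rename-exts θ ρ (there x) =
  trans (rename-rename there (ext ρ) (θ x)) (sym (rename-rename ρ there (θ x)))

rename-subst : (θ : Sub K Γ Δ) (ρ : Ren Δ Θ) (t : Tm K Γ τ) →
               rename ρ (subst θ t) ≡ subst (rename ρ ∘ θ) t
rename-subst θ ρ (var x)    = refl
rename-subst θ ρ (con c)    = refl
rename-subst θ ρ (Φ i)      = refl
rename-subst θ ρ (ƛ t)      =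
  cong ƛ (trans (rename-subst (exts θ) (ext ρ) t) (subst-cong (rename-exts θ ρ) t))
rename-subst θ ρ (t · u)    = cong₂ _·_ (rename-subst θ ρ t) (rename-subst θ ρ u)
rename-subst θ ρ (pair t u) = cong₂ pair (rename-subst θ ρ t) (rename-subst θ ρ u)
rename-subst θ ρ (π₀ t)     = cong π₀ (rename-subst θ ρ t)
rename-subst θ ρ (π₁ t)     = cong π₁ (rename-subst θ ρ t)

subst-exts : (θ : Sub K Γ Δ) (θ′ : Sub K Δ Θ) (x : τ ∈ σ ∷ Γ) →
             subst (exts θ′) (exts θ x) ≡ exts (subst θ′ ∘ θ) x
subst-exts θ θ′ (here _)  = refl
subst-exts θ θ′ (there x) =
  trans (subst-rename there (exts θ′) (θ x)) (sym (rename-subst θ′ there (θ x)))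

subst-subst : (θ : Sub K Γ Δ) (θ′ : Sub K Δ Θ) (t : Tm K Γ τ) →
              subst θ′ (subst θ t) ≡ subst (subst θ′ ∘ θ) t
subst-subst θ θ′ (var x)    = refl
subst-subst θ θ′ (con c)    = refl
subst-subst θ θ′ (Φ i)      = refl
subst-subst θ θ′ (ƛ t)      =
  cong ƛ (trans (subst-subst (exts θ) (exts θ′) t) (subst-cong (subst-exts θ θ′) t))
subst-subst θ θ′ (t · u)    = cong₂ _·_ (subst-subst θ θ′ t) (subst-subst θ θ′ u)
subst-subst θ θ′ (pair t u) = cong₂ pair (subst-subst θ θ′ t) (subst-subst θ θ′ u)
subst-subst θ θ′ (π₀ t)     = cong π₀ (subst-subst θ θ′ t)
subst-subst θ θ′ (π₁ t)     = cong π₁ (subst-subst θ θ′ t)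

subst-id : {θ : Sub K Γ Γ} → (∀ {τ} (x : τ ∈ Γ) → θ x ≡ var x) →
           (t : Tm K Γ τ) → subst θ t ≡ t
subst-id e (var x)    = e x
subst-id e (con c)    = refl
subst-id e (Φ i)      = refl
subst-id e (ƛ t)      =
  cong ƛ (subst-id (λ { (here _) → refl ; (there x) → cong (rename there) (e x) }) t)
subst-id e (t · u)    = cong₂ _·_ (subst-id e t) (subst-id e u)
subst-id e (pair t u) = cong₂ pair (subst-id e t) (subst-id e u)
subst-id e (π₀ t)     = cong π₀ (subst-id e t)
subst-id e (π₁ t)     = cong π₁ (subst-id e t)

infixr 5 _∷ˢ_

_∷ˢ_ : Tm K Δ σ → Sub K Γ Δ → Sub K (σ ∷ Γ) Δ
(u ∷ˢ θ) (here refl) = u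
(u ∷ˢ θ) (there x)   = θ x

-- The weakening introduced by `exts` is undone by `single u`. This identifies the β-contractum in
-- the abstraction case of both `Reduces-subst` and `Comp-subst`.
exts-[]₀ : (θ : Sub K Γ Δ) (t : Tm K (σ ∷ Γ) τ) (u : Tm K Δ σ) →
           subst (exts θ) t [ u ]₀ ≡ subst (u ∷ˢ θ) t
exts-[]₀ {σ = σ} θ t u = trans (subst-subst (exts θ) (single u) t) (subst-cong pointwise t)
  where
  pointwise : ∀ {τ} (x : τ ∈ σ ∷ _) → subst (single u) (exts θ x) ≡ (u ∷ˢ θ) x
  pointwise (here refl) = refl
  pointwise (there x)   =
    trans (subst-rename there (single u) (θ x)) (subst-id (λ _ → refl) (θ x))

-- The set-theoretic model

Val : Ty → Set
Val N       = ℕ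
Val Bool    = Bool.Bool
Val U       = Update
Val (σ ⇒ τ) = Val σ → Val τ
Val (σ ⊗ τ) = Val σ × Val τ

Env : Ctx → Set
Env Γ = ∀ {τ} → τ ∈ Γ → Val τ

[]ᵉ : Env []
[]ᵉ ()

infixr 5 _∷ᵉ_

_∷ᵉ_ : Val σ → Env Γ → Env (σ ∷ Γ)
(a ∷ᵉ ρ) (here refl) = a
(a ∷ᵉ ρ) (there x)   = ρ x

primrec : {A : Set} → A → (ℕ → A → A) → ℕ → A
primrec a f zero    = a
primrec a f (suc n) = f n (primrec a f n)

⟦_⟧ᶜ : Const τ → Val τ
⟦ zeroᶜ ⟧ᶜ   = zero
⟦ sucᶜ ⟧ᶜ    = suc
⟦ trueᶜ ⟧ᶜ   = true
⟦ falseᶜ ⟧ᶜ  = false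
⟦ ifᶜ τ ⟧ᶜ   = if_then_else_
⟦ recᶜ τ ⟧ᶜ  = primrec
⟦ updᶜ V ⟧ᶜ  = V
⟦ minᶜ ⟧ᶜ    = minimum
⟦ getᶜ ⟧ᶜ    = getU
⟦ mkupdᶜ ⟧ᶜ  = singleton
⟦ ∪ᶜ ⟧ᶜ      = _∪_

-- The parameter `φ` interprets the extra constants, so one semantics serves both `𝒯`, which has
-- none, and `𝒯class`, read through the functions of a state.
⟦_⟧ : Tm K Γ τ → (K → ℕ → ℕ) → Env Γ → Val τ
⟦ var x ⟧    φ ρ = ρ x
⟦ con c ⟧    φ ρ = ⟦ c ⟧ᶜ
⟦ Φ i ⟧      φ ρ = φ i
⟦ ƛ t ⟧      φ ρ = λ a → ⟦ t ⟧ φ (a ∷ᵉ ρ)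
⟦ t · u ⟧    φ ρ = ⟦ t ⟧ φ ρ (⟦ u ⟧ φ ρ)
⟦ pair t u ⟧ φ ρ = ⟦ t ⟧ φ ρ , ⟦ u ⟧ φ ρ
⟦ π₀ t ⟧     φ ρ = proj₁ (⟦ t ⟧ φ ρ)
⟦ π₁ t ⟧     φ ρ = proj₂ (⟦ t ⟧ φ ρ)

⟦numeral⟧ : ∀ n {φ : K → ℕ → ℕ} {ρ : Env Γ} → ⟦ numeral n ⟧ φ ρ ≡ n
⟦numeral⟧ zero    = refl
⟦numeral⟧ (suc n) = cong suc (⟦numeral⟧ n)

-- Values are compared extensionally, because function extensionality is not
-- available to validate ξ-ƛ.
Eq : ∀ τ → Val τ → Val τ → Set
Eq N       a b = a ≡ b
Eq Bool    a b = a ≡ b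
Eq U       a b = a ≡ b
Eq (σ ⇒ τ) f g = ∀ a b → Eq σ a b → Eq τ (f a) (g b)
Eq (σ ⊗ τ) p q = Eq σ (proj₁ p) (proj₁ q) × Eq τ (proj₂ p) (proj₂ q)

Eq-sym : ∀ τ {a b} → Eq τ a b → Eq τ b a
Eq-sym N       e         = sym e
Eq-sym Bool    e         = sym e
Eq-sym U       e         = sym e
Eq-sym (σ ⇒ τ) e a b a~b = Eq-sym τ (e b a (Eq-sym σ a~b))
Eq-sym (σ ⊗ τ) (e , e′)  = Eq-sym σ e , Eq-sym τ e′

Eq-trans : ∀ τ {a b c} → Eq τ a b → Eq τ b c → Eq τ a c
Eq-trans N       e e′ = trans e e′
Eq-trans Bool    e e′ = trans e e′
Eq-trans U       e e′ = trans e e′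
-- `Eq` is only a partial equivalence: that `a` is related to itself has to be drawn from `a~b`, as
-- it cannot be assumed of an arbitrary function.
Eq-trans (σ ⇒ τ) e e′ a b a~b =
  Eq-trans τ (e a a (Eq-trans σ a~b (Eq-sym σ a~b))) (e′ a b a~b)
Eq-trans (σ ⊗ τ) (e₁ , e₂) (e₁′ , e₂′) = Eq-trans σ e₁ e₁′ , Eq-trans τ e₂ e₂′

-- Congruence and soundness of the interpretation

EqEnv : Env Γ → Env Γ → Set
EqEnv {Γ} ρ ρ′ = ∀ {τ} (x : τ ∈ Γ) → Eq τ (ρ x) (ρ′ x)

EqEnv-∷ : ∀ {ρ ρ′ : Env Γ} {a b} → Eq σ a b → EqEnv ρ ρ′ → EqEnv (a ∷ᵉ ρ) (b ∷ᵉ ρ′)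
EqEnv-∷ a~b e (here refl) = a~b
EqEnv-∷ a~b e (there x)   = e x

EqEnv-reflˡ : {ρ ρ′ : Env Γ} → EqEnv ρ ρ′ → EqEnv ρ ρ
EqEnv-reflˡ e {τ} x = Eq-trans τ (e x) (Eq-sym τ (e x))

EqEnv-reflʳ : {ρ ρ′ : Env Γ} → EqEnv ρ ρ′ → EqEnv ρ′ ρ′
EqEnv-reflʳ e {τ} x = Eq-trans τ (Eq-sym τ (e x)) (e x)

⟦⟧ᶜ-refl : (c : Const τ) → Eq τ ⟦ c ⟧ᶜ ⟦ c ⟧ᶜ
⟦⟧ᶜ-refl zeroᶜ    = refl
⟦⟧ᶜ-refl sucᶜ     _ _ refl = refl
⟦⟧ᶜ-refl trueᶜ    = refl
⟦⟧ᶜ-refl falseᶜ   = refl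
⟦⟧ᶜ-refl (ifᶜ τ)  true  _ refl _ _ e _ _ _ = e
⟦⟧ᶜ-refl (ifᶜ τ)  false _ refl _ _ _ _ _ e = e
⟦⟧ᶜ-refl (recᶜ τ) a b a~b f g f~g n _ refl = go n
  where
  go : ∀ n → Eq τ (primrec a f n) (primrec b g n)
  go zero    = a~b
  go (suc n) = f~g n n refl _ _ (go n)
⟦⟧ᶜ-refl (updᶜ V) = refl
⟦⟧ᶜ-refl minᶜ     _ _ refl = refl
⟦⟧ᶜ-refl getᶜ     _ _ refl _ _ refl _ _ refl _ _ refl = refl
⟦⟧ᶜ-refl mkupdᶜ   _ _ refl _ _ refl _ _ refl = refl
⟦⟧ᶜ-refl ∪ᶜ       _ _ refl _ _ refl = refl

-- With a self-related environment on both sides, this makes denotations of terms self-related,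
-- which takes the place of reflexivity of `Eq`.
⟦⟧-cong : ∀ {φ : K → ℕ → ℕ} (t : Tm K Γ τ) {ρ ρ′ : Env Γ} → EqEnv ρ ρ′ →
          Eq τ (⟦ t ⟧ φ ρ) (⟦ t ⟧ φ ρ′)
⟦⟧-cong (var x)        e = e x
⟦⟧-cong (con c)        e = ⟦⟧ᶜ-refl c
⟦⟧-cong {φ = φ} (Φ i)  e _ _ = cong (φ i)
⟦⟧-cong (ƛ t)          e _ _ a~b = ⟦⟧-cong t (EqEnv-∷ a~b e)
⟦⟧-cong (t · u)        e = ⟦⟧-cong t e _ _ (⟦⟧-cong u e)
⟦⟧-cong (pair t u)     e = ⟦⟧-cong t e , ⟦⟧-cong u e
⟦⟧-cong (π₀ t)         e = proj₁ (⟦⟧-cong t e)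
⟦⟧-cong (π₁ t)         e = proj₂ (⟦⟧-cong t e)

⟦rename⟧ : ∀ {φ : K → ℕ → ℕ} (r : Ren Γ Δ) (t : Tm K Γ τ) {ρ : Env Δ} {ρ′ : Env Γ} →
           EqEnv (λ x → ρ (r x)) ρ′ → Eq τ (⟦ rename r t ⟧ φ ρ) (⟦ t ⟧ φ ρ′)
⟦rename⟧ r (var x)       e = e x
⟦rename⟧ r (con c)       e = ⟦⟧ᶜ-refl c
⟦rename⟧ {φ = φ} r (Φ i) e _ _ = cong (φ i)
⟦rename⟧ r (ƛ t)         e _ _ a~b =
  ⟦rename⟧ (ext r) t λ { (here refl) → a~b ; (there x) → e x }
⟦rename⟧ r (t · u)       e = ⟦rename⟧ r t e _ _ (⟦rename⟧ r u e)
⟦rename⟧ r (pair t u)    e = ⟦rename⟧ r t e , ⟦rename⟧ r u e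
⟦rename⟧ r (π₀ t)        e = proj₁ (⟦rename⟧ r t e)
⟦rename⟧ r (π₁ t)        e = proj₂ (⟦rename⟧ r t e)

-- Self-relatedness of `ρ` is what allows the terms `θ x` to be weakened under a binder.
⟦subst⟧ : ∀ {φ : K → ℕ → ℕ} (θ : Sub K Γ Δ) (t : Tm K Γ τ) {ρ : Env Δ} {ρ′ : Env Γ} →
          EqEnv ρ ρ → EqEnv (λ x → ⟦ θ x ⟧ φ ρ) ρ′ →
          Eq τ (⟦ subst θ t ⟧ φ ρ) (⟦ t ⟧ φ ρ′)
⟦subst⟧ θ (var x)       r e = e x
⟦subst⟧ θ (con c)       r e = ⟦⟧ᶜ-refl c
⟦subst⟧ {φ = φ} θ (Φ i) r e _ _ = cong (φ i)
⟦subst⟧ θ (ƛ {σ} t)     r e _ _ a~b =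
  ⟦subst⟧ (exts θ) t (EqEnv-∷ (Eq-trans σ a~b (Eq-sym σ a~b)) r) λ where
    (here refl)   → a~b
    {τ} (there x) → Eq-trans τ (⟦rename⟧ there (θ x) r) (e x)
⟦subst⟧ θ (t · u)       r e = ⟦subst⟧ θ t r e _ _ (⟦subst⟧ θ u r e)
⟦subst⟧ θ (pair t u)    r e = ⟦subst⟧ θ t r e , ⟦subst⟧ θ u r e
⟦subst⟧ θ (π₀ t)        r e = proj₁ (⟦subst⟧ θ t r e)
⟦subst⟧ θ (π₁ t)        r e = proj₂ (⟦subst⟧ θ t r e)

-- Two related environments make the induction pass through `ξ-ƛ`, where the two sides receive
-- related but possibly different arguments.
⟶-sound : ∀ {φ : K → ℕ → ℕ} {t u : Tm K Γ τ} → t ⟶ u → {ρ ρ′ : Env Γ} → EqEnv ρ ρ′ →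
          Eq τ (⟦ t ⟧ φ ρ) (⟦ u ⟧ φ ρ′)
⟶-sound {τ = τ} (β t u) e =
  Eq-sym τ (⟦subst⟧ (single u) t (EqEnv-reflʳ e) λ where
    (here refl)   → Eq-sym _ (⟦⟧-cong u e)
    {τ} (there x) → Eq-sym τ (e x))
⟶-sound (β-π₀ t u)        e = ⟦⟧-cong t e
⟶-sound (β-π₁ t u)        e = ⟦⟧-cong u e
⟶-sound (if-true t u)     e = ⟦⟧-cong t e
⟶-sound (if-false t u)    e = ⟦⟧-cong u e
⟶-sound (rec-zero u v)    e = ⟦⟧-cong u e
⟶-sound (rec-suc u v t)   e = ⟦⟧-cong (v · t · (con (recᶜ _) · u · v · t)) e
⟶-sound (δ-min V)         e = sym (⟦numeral⟧ (minimum V))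
⟶-sound {K = K} {Γ = Γ} {φ = φ} (δ-get V a n l)   {ρ} e
  rewrite ⟦numeral⟧ {K} {Γ} a {φ} {ρ} | ⟦numeral⟧ {K} {Γ} n {φ} {ρ}
        | ⟦numeral⟧ {K} {Γ} l {φ} {ρ} =
  sym (⟦numeral⟧ (getU V a n l))
⟶-sound {K = K} {Γ = Γ} {φ = φ} (δ-mkupd a n m) {ρ} e
  rewrite ⟦numeral⟧ {K} {Γ} a {φ} {ρ} | ⟦numeral⟧ {K} {Γ} n {φ} {ρ}
        | ⟦numeral⟧ {K} {Γ} m {φ} {ρ} = refl
⟶-sound (δ-∪ V W)         e = refl
⟶-sound (ξ-ƛ r)           e _ _ a~b = ⟶-sound r (EqEnv-∷ a~b e)
⟶-sound (ξ-·ˡ {u = u} r)  e = ⟶-sound r e _ _ (⟦⟧-cong u e)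
⟶-sound (ξ-·ʳ {t = t} r)  e = ⟦⟧-cong t e _ _ (⟶-sound r e)
⟶-sound (ξ-pairˡ {u = u} r) e = ⟶-sound r e , ⟦⟧-cong u e
⟶-sound (ξ-pairʳ {t = t} r) e = ⟦⟧-cong t e , ⟶-sound r e
⟶-sound (ξ-π₀ r)          e = proj₁ (⟶-sound r e)
⟶-sound (ξ-π₁ r)          e = proj₂ (⟶-sound r e)

⟶*-sound : ∀ {φ : K → ℕ → ℕ} {t u : Tm K Γ τ} → t ⟶* u → {ρ ρ′ : Env Γ} → EqEnv ρ ρ′ →
           Eq τ (⟦ t ⟧ φ ρ) (⟦ u ⟧ φ ρ′)
⟶*-sound         {t = t} ε        e = ⟦⟧-cong t e
⟶*-sound {τ = τ}         (r ◅ rs) e = Eq-trans τ (⟶-sound r (EqEnv-reflˡ e)) (⟶*-sound rs e)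

-- Canonical forms and adequacy of the model

data Atomic : Ty → Set where
  N    : Atomic N
  Bool : Atomic Bool
  U    : Atomic U

canonical : Atomic τ → Val τ → Tm K Γ τ
canonical N    n     = numeral n
canonical Bool true  = con trueᶜ
canonical Bool false = con falseᶜ
canonical U    V     = con (updᶜ V)

⟦canonical⟧ : (b : Atomic τ) {d : Val τ} {φ : K → ℕ → ℕ} {ρ : Env Γ} →
              Eq τ (⟦ canonical b d ⟧ φ ρ) d
⟦canonical⟧ N    {n}     = ⟦numeral⟧ n
⟦canonical⟧ Bool {true}  = refl
⟦canonical⟧ Bool {false} = refl
⟦canonical⟧ U            = refl

Eq⇒≡ : Atomic τ → ∀ {a b} → Eq τ a b → a ≡ b
Eq⇒≡ N    e = e
Eq⇒≡ Bool e = e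
Eq⇒≡ U    e = e

numeral-normal : ∀ n → IsNormalForm (_⟶_ {K} {Γ}) (numeral n)
numeral-normal (suc n) (_ , ξ-·ʳ r) = numeral-normal n (_ , r)

canonical-normal : (b : Atomic τ) (d : Val τ) → IsNormalForm (_⟶_ {K} {Γ}) (canonical b d)
canonical-normal N    n     = numeral-normal n
canonical-normal Bool true  (_ , ())
canonical-normal Bool false (_ , ())
canonical-normal U    V     (_ , ())

-- A logical relation between closed terms and values; its instances at atomic types are adequacy.
Reduces : ∀ τ → 𝒯 [] τ → Val τ → Set
Reduces N       t d = t ⟶* canonical N d
Reduces Bool    t d = t ⟶* canonical Bool d
Reduces U       t d = t ⟶* canonical U d
Reduces (σ ⇒ τ) t f = ∀ {u a} → Reduces σ u a → Reduces τ (t · u) (f a)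
Reduces (σ ⊗ τ) t p = Reduces σ (π₀ t) (proj₁ p) × Reduces τ (π₁ t) (proj₂ p)

Reduces-◅◅ : ∀ τ {t u d} → t ⟶* u → Reduces τ u d → Reduces τ t d
Reduces-◅◅ N       rs q       = rs ◅◅ q
Reduces-◅◅ Bool    rs q       = rs ◅◅ q
Reduces-◅◅ U       rs q       = rs ◅◅ q
Reduces-◅◅ (σ ⇒ τ) rs q p     = Reduces-◅◅ τ (gmap (_· _) ξ-·ˡ rs) (q p)
Reduces-◅◅ (σ ⊗ τ) rs (p , q) =
  Reduces-◅◅ σ (gmap π₀ ξ-π₀ rs) p , Reduces-◅◅ τ (gmap π₁ ξ-π₁ rs) q

Reduces⇒⟶* : (b : Atomic τ) {t : 𝒯 [] τ} {d : Val τ} → Reduces τ t d → t ⟶* canonical b d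
Reduces⇒⟶* N    rs = rs
Reduces⇒⟶* Bool rs = rs
Reduces⇒⟶* U    rs = rs

-- The δ-rules fire only on canonical arguments. An atomic argument can first be reduced to its
-- canonical form, which leaves one case for each value.
Reduces-⇒ : (b : Atomic σ) {t : 𝒯 [] (σ ⇒ τ)} {f : Val σ → Val τ} →
            (∀ d → Reduces τ (t · canonical b d) (f d)) → Reduces (σ ⇒ τ) t f
Reduces-⇒ {τ = τ} b h q = Reduces-◅◅ τ (gmap (_ ·_) ξ-·ʳ (Reduces⇒⟶* b q)) (h _)

Reduces-con : (c : Const τ) → Reduces τ (con c) ⟦ c ⟧ᶜ
Reduces-con zeroᶜ    = ε
Reduces-con sucᶜ     = gmap (con sucᶜ ·_) ξ-·ʳ
Reduces-con trueᶜ    = ε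
Reduces-con falseᶜ   = ε
Reduces-con (ifᶜ τ)  {a = true}  rs p q =
  Reduces-◅◅ τ (gmap (λ b → con (ifᶜ τ) · b · _ · _) (ξ-·ˡ ∘ ξ-·ˡ ∘ ξ-·ʳ) rs
                  ◅◅ if-true _ _ ◅ ε) p
Reduces-con (ifᶜ τ)  {a = false} rs p q =
  Reduces-◅◅ τ (gmap (λ b → con (ifᶜ τ) · b · _ · _) (ξ-·ˡ ∘ ξ-·ˡ ∘ ξ-·ʳ) rs
                  ◅◅ if-false _ _ ◅ ε) q
Reduces-con (recᶜ τ) {u} {a} p {v} {f} q = Reduces-⇒ {τ = τ} N go
  where
  go : ∀ n → Reduces τ (con (recᶜ τ) · u · v · numeral n) (primrec a f n)
  go zero    = Reduces-◅◅ τ (rec-zero u v ◅ ε) p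
  go (suc n) = Reduces-◅◅ τ (rec-suc u v (numeral n) ◅ ε) (q {numeral n} ε (go n))
Reduces-con (updᶜ V) = ε
Reduces-con minᶜ     = Reduces-⇒ {τ = N} U λ V → δ-min V ◅ ε
Reduces-con getᶜ     = Reduces-⇒ {τ = N ⇒ N ⇒ N ⇒ N} U λ V →
  Reduces-⇒ {τ = N ⇒ N ⇒ N} N λ a → Reduces-⇒ {τ = N ⇒ N} N λ n →
  Reduces-⇒ {τ = N} N λ l → δ-get V a n l ◅ ε
Reduces-con mkupdᶜ   = Reduces-⇒ {τ = N ⇒ N ⇒ U} N λ a →
  Reduces-⇒ {τ = N ⇒ U} N λ n → Reduces-⇒ {τ = U} N λ m → δ-mkupd a n m ◅ ε
Reduces-con ∪ᶜ       = Reduces-⇒ {τ = U ⇒ U} U λ V → Reduces-⇒ {τ = U} U λ W → δ-∪ V W ◅ ε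

noΦ : ⊥ → ℕ → ℕ
noΦ ()

Reduces-subst : (t : 𝒯 Γ τ) (θ : Sub ⊥ Γ []) {ρ : Env Γ} →
                (∀ {τ} (x : τ ∈ Γ) → Reduces τ (θ x) (ρ x)) →
                Reduces τ (subst θ t) (⟦ t ⟧ noΦ ρ)
Reduces-subst (var x)    θ e = e x
Reduces-subst (con c)    θ e = Reduces-con c
Reduces-subst (ƛ {σ} {τ} t) θ {ρ} e {u} {a} p =
  Reduces-◅◅ τ (β _ u ◅ ε) (transport (λ v → Reduces τ v (⟦ t ⟧ noΦ (a ∷ᵉ ρ)))
    (sym (exts-[]₀ θ t u))
    (Reduces-subst t (u ∷ˢ θ) λ { (here refl) → p ; (there x) → e x }))
Reduces-subst (t · u)    θ e = Reduces-subst t θ e (Reduces-subst u θ e)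
Reduces-subst (pair {σ} {τ} t u) θ e =
  Reduces-◅◅ σ (β-π₀ _ _ ◅ ε) (Reduces-subst t θ e) ,
  Reduces-◅◅ τ (β-π₁ _ _ ◅ ε) (Reduces-subst u θ e)
Reduces-subst (π₀ t)     θ e = proj₁ (Reduces-subst t θ e)
Reduces-subst (π₁ t)     θ e = proj₂ (Reduces-subst t θ e)

value : 𝒯 [] τ → Val τ
value t = ⟦ t ⟧ noΦ []ᵉ

⟶*-canonical : (b : Atomic τ) (t : 𝒯 [] τ) → t ⟶* canonical b (value t)
⟶*-canonical {τ = τ} b t = Reduces⇒⟶* b
  (transport (λ u → Reduces τ u (value t)) (subst-id (λ ()) t)
    (Reduces-subst t (λ ()) {[]ᵉ} λ ()))

≈⇒Eq : {t u : 𝒯 [] τ} → t ≈ u → Eq τ (value t) (value u)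
≈⇒Eq {τ = τ} (w , _ , t⟶w , u⟶w) =
  Eq-trans τ (⟶*-sound t⟶w {[]ᵉ} {[]ᵉ} λ ()) (Eq-sym τ (⟶*-sound u⟶w λ ()))

-- Both terms reduce to the canonical term of the shared value, which is normal. At higher types
-- equal values do not force equal normal forms, so the converse of `≈⇒Eq` is confined to atomic
-- types.
Eq⇒≈ : Atomic τ → (t u : 𝒯 [] τ) → Eq τ (value t) (value u) → t ≈ u
Eq⇒≈ b t u e =
  canonical b (value t) , canonical-normal b (value t) , ⟶*-canonical b t ,
  transport (λ d → u ⟶* canonical b d) (sym (Eq⇒≡ b e)) (⟶*-canonical b u)

-- States

fun : State → ℕ → ℕ → ℕ
fun s = value s

⟦at⟧ : ∀ s i u → value (s at i · u) ≡ fun s i (value u)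
⟦at⟧ s i u = cong (λ j → fun s j (value u)) (⟦numeral⟧ i)

⟦_⟧ˢ : 𝒯class [] τ → State → Val τ
⟦ t ⟧ˢ s = ⟦ t ⟧ (fun s) []ᵉ

-- Syntactic replacement of the constants by `s` amounts to interpreting them by `fun s`.
-- Definedness thus becomes a property of one denotation under a varying state.
⟦[]ˢ⟧ : ∀ (t : 𝒯class Γ τ) s {ρ ρ′ : Env Γ} → EqEnv ρ ρ′ →
        Eq τ (⟦ t [ s ]ˢ ⟧ noΦ ρ) (⟦ t ⟧ (fun s) ρ′)
⟦[]ˢ⟧ (var x)    s e = e x
⟦[]ˢ⟧ (con c)    s e = ⟦⟧ᶜ-refl c
⟦[]ˢ⟧ (Φ i)      s e a _ refl =
  trans (⟦rename⟧ {φ = noΦ} (λ ()) (s at i) {ρ′ = []ᵉ} (λ ()) a a refl)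
        (cong (λ j → fun s j a) (⟦numeral⟧ i))
⟦[]ˢ⟧ (ƛ t)      s e _ _ a~b = ⟦[]ˢ⟧ t s (EqEnv-∷ a~b e)
⟦[]ˢ⟧ (t · u)    s e = ⟦[]ˢ⟧ t s e _ _ (⟦[]ˢ⟧ u s e)
⟦[]ˢ⟧ (pair t u) s e = ⟦[]ˢ⟧ t s e , ⟦[]ˢ⟧ u s e
⟦[]ˢ⟧ (π₀ t)     s e = proj₁ (⟦[]ˢ⟧ t s e)
⟦[]ˢ⟧ (π₁ t)     s e = proj₂ (⟦[]ˢ⟧ t s e)

-- A pointwise change of `s` made inside `𝒯`: `get` on a one-triple update returns `y` at the pair
-- `i`, `m` and elsewhere its default, the old value.
override : State → ℕ → ℕ → ℕ → State
override s i m y =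
  ƛ (ƛ (con getᶜ · con (updᶜ (singleton i m y)) · j · x · (rename (λ ()) s · j · x)))
  where
  x = var (here refl)
  j = var (there (here refl))

fun-override : ∀ s i m y j x →
               fun (override s i m y) j x ≡ getU (singleton i m y) j x (fun s j x)
fun-override s i m y j x = cong (getU (singleton i m y) j x)
  (⟦rename⟧ {φ = noΦ} (λ ()) s {ρ′ = []ᵉ} (λ ()) j j refl x x refl)

getU-hit : ∀ i m y l → getU (singleton i m y) i m l ≡ y
getU-hit i m y l with i ≟ i | m ≟ m
... | yes _  | yes _  = refl
... | no i≢i | _      = contradiction refl i≢i
... | yes _  | no m≢m = contradiction refl m≢m

getU-miss : ∀ i m y {j x} l → ((j , x) ≡ (i , m) → ⊥) → getU (singleton i m y) j x l ≡ l
getU-miss i m y {j} {x} l ≢ with j ≟ i | x ≟ m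
... | yes refl | yes refl = contradiction refl ≢
... | yes _    | no _     = refl
... | no _     | _        = refl

-- Truth of arithmetical formulas

EqVec : ∀ {k} → Vec (𝒯 [] N) k → Vec (𝒯 [] N) k → Set
EqVec {k} ts us = EqEnv {Nats k} (λ x → value (closing ts x)) (λ x → value (closing us x))

EqVec-∷ : ∀ {k t u} {ts us : Vec (𝒯 [] N) k} →
          value t ≡ value u → EqVec ts us → EqVec (t ∷ ts) (u ∷ us)
EqVec-∷ e es (here refl) = e
EqVec-∷ e es (there x)   = es x

EqVec-sym : ∀ {k} {ts us : Vec (𝒯 [] N) k} → EqVec ts us → EqVec us ts
EqVec-sym e {τ} x = Eq-sym τ (e x)

EqVec-refl : ∀ {k} {ts : Vec (𝒯 [] N) k} → EqVec ts ts
EqVec-refl {ts = ts} x = ⟦⟧-cong (closing ts x) λ ()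

-- Truth depends on the parameter terms only through their values. In `dm` this allows a numeral
-- witness to be exchanged for the term by which a state computes it.
True-resp : ∀ {k} (A : Formula k) {ts us} → EqVec ts us → True A ts → True A us
True-resp (atom t) {ts} {us} e h = Eq⇒≈ Bool (subst (closing us) t) (con trueᶜ) (begin
  value (subst (closing us) t)                  ≡⟨ ⟦subst⟧ (closing us) t (λ ()) (EqVec-refl {ts = us}) ⟩
  ⟦ t ⟧ noΦ (λ x → value (closing us x))        ≡⟨ ⟦subst⟧ (closing ts) t (λ ()) e ⟨
  value (subst (closing ts) t)                  ≡⟨ ≈⇒Eq h ⟩
  true                                          ∎)
  where open ≡-Reasoning
True-resp (A ∧ᶠ B) e (a , b) = True-resp A e a , True-resp B e b
True-resp (A ∨ᶠ B) e h       = Sum.map (True-resp A e) (True-resp B e) h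
-- The premise is transported backwards, hence the symmetry.
True-resp (A →ᶠ B) {ts} {us} e h a =
  True-resp B e (h (True-resp A (EqVec-sym {ts = ts} {us} e) a))
True-resp (∀ᶠ A)   e h n     = True-resp A (EqVec-∷ {t = numeral n} refl e) (h n)
True-resp (∃ᶠ A)   e (n , h) = n , True-resp A (EqVec-∷ {t = numeral n} refl e) h

Holds-resp : ∀ A ns {t u} → value t ≡ value u → Holds A ns t → Holds A ns u
Holds-resp A ns {t} e =
  True-resp (body A) (EqVec-∷ {t = t} e (EqVec-refl {ts = numerals ns}))

module Computable
  (em : ExcludedMiddle 0ℓ)
  (assoc : ArithFormula ⤖ ℕ) (coding : Coding) (Γ₀ : List ArithFormula)
  where

  open Computability assoc coding Γ₀
  open Coding coding using (⟨_⟩; injective; surjective)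

  -- The order on states in terms of values

  ≽-fun : ∀ {s s′} → s′ ≽ s → ∀ {i u} → dm s (i , u) → fun s i (value u) ≡ fun s′ i (value u)
  ≽-fun {s} {s′} s′≽s {i} {u} d =
    trans (sym (⟦at⟧ s i u)) (trans (≈⇒Eq (s′≽s d)) (⟦at⟧ s′ i u))

  fun-≽ : ∀ {s s′} → (∀ {i u} → dm s (i , u) → fun s i (value u) ≡ fun s′ i (value u)) → s′ ≽ s
  fun-≽ {s} {s′} h {i} {u} d = Eq⇒≈ N (s at i · u) (s′ at i · u)
    (trans (⟦at⟧ s i u) (trans (h d) (sym (⟦at⟧ s′ i u))))

  ≽-refl : ∀ s → s ≽ s
  ≽-refl s = fun-≽ {s} {s} λ _ → refl

  -- An extension keeps the value of `s` at each point of its domain, so whatever witnesses the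
  -- formula there still does.
  dm-mono : ∀ {s s′ p} → s′ ≽ s → dm s p → dm s′ p
  dm-mono s′≽s d@(A , ns , refl , refl , h) =
    A , ns , refl , refl , λ A∈Γ ∃y → Holds-resp A ns (≈⇒Eq (s′≽s d)) (h A∈Γ ∃y)

  -- Agreement of `s″` with `s′` is given only on the domain of `s′`, so a point of the domain of
  -- `s` must first be moved there by `dm-mono`.
  ≽-trans : ∀ {s s′ s″} → s″ ≽ s′ → s′ ≽ s → s″ ≽ s
  ≽-trans {s} {s′} {s″} q p = fun-≽ {s} {s″} λ d →
    trans (≽-fun {s} {s′} p d) (≽-fun {s′} {s″} q (dm-mono {s} {s′} p d))

  -- Definedness in the model and locality of computability

  DefinedIn⇒Eq : ∀ (t : 𝒯class [] τ) {s} → DefinedIn t s →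
                 ∀ {s′} → s′ ≽ s → Eq τ (⟦ t ⟧ˢ s′) (⟦ t ⟧ˢ s)
  DefinedIn⇒Eq {τ = τ} t {s} def {s′} s′≽s =
    Eq-trans τ (Eq-sym τ (⟦[]ˢ⟧ t s′ λ ()))
      (Eq-trans τ (≈⇒Eq (def s′ s′≽s)) (⟦[]ˢ⟧ t s λ ()))

  Eq⇒DefinedIn : Atomic τ → ∀ (t : 𝒯class [] τ) {s} →
                 (∀ {s′} → s′ ≽ s → Eq τ (⟦ t ⟧ˢ s′) (⟦ t ⟧ˢ s)) → DefinedIn t s
  Eq⇒DefinedIn {τ = τ} b t {s} h s′ s′≽s = Eq⇒≈ b (t [ s′ ]ˢ) (t [ s ]ˢ)
    (Eq-trans τ (⟦[]ˢ⟧ t s′ λ ()) (Eq-trans τ (h s′≽s) (Eq-sym τ (⟦[]ˢ⟧ t s λ ()))))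

  Comp⇒Dense : Atomic τ → ∀ {t} → Comp τ t → DenselyDefined t
  Comp⇒Dense N    c = c
  Comp⇒Dense Bool c = c
  Comp⇒Dense U    c = c

  Dense⇒Comp : Atomic τ → ∀ {t} → DenselyDefined t → Comp τ t
  Dense⇒Comp N    d = d
  Dense⇒Comp Bool d = d
  Dense⇒Comp U    d = d

  AgreeFrom : State → 𝒯class [] τ → 𝒯class [] τ → Set
  AgreeFrom {τ} s t u = ∀ {s′} → s′ ≽ s → Eq τ (⟦ t ⟧ˢ s′) (⟦ u ⟧ˢ s′)

  LocallyComp : ∀ τ → 𝒯class [] τ → Set
  LocallyComp τ t = ∀ s → ∃[ s′ ] s′ ≽ s × (∃[ u ] Comp τ u × AgreeFrom s′ t u)

  -- Agreement beyond a state passes from a function to its applications and from a pair to its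
  -- projections, which reduces the claim to atomic types.
  Comp-local : ∀ τ t → LocallyComp τ t → Comp τ t
  Comp-local-atomic : Atomic τ → ∀ t → LocallyComp τ t → DenselyDefined t

  Comp-local N       = Comp-local-atomic N
  Comp-local Bool    = Comp-local-atomic Bool
  Comp-local U       = Comp-local-atomic U
  Comp-local (σ ⇒ τ) t loc v cv = Comp-local τ (t · v) λ s →
    let s′ , s′≽s , u , cu , t~u = loc s
    in  s′ , s′≽s , u · v , cu v cv , λ p → t~u p _ _ (⟦⟧-cong v λ ())
  Comp-local (σ ⊗ τ) t loc =
    (Comp-local σ (π₀ t) λ s → let s′ , s′≽s , u , cu , t~u = loc s
                                 in  s′ , s′≽s , π₀ u , proj₁ cu , λ p → proj₁ (t~u p)) ,
    (Comp-local τ (π₁ t) λ s → let s′ , s′≽s , u , cu , t~u = loc s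
                                 in  s′ , s′≽s , π₁ u , proj₂ cu , λ p → proj₂ (t~u p))

  -- At `s₁` the agreement of `t` with `u` begins, and at `s₂` the value of `u` is settled; beyond
  -- `s₂` both facts together keep `t` constant.
  Comp-local-atomic {τ} b t loc s =
    let s₁ , s₁≽s  , u , cu , t~u = loc s
        s₂ , s₂≽s₁ , def          = Comp⇒Dense b cu s₁
    in  s₂ , ≽-trans {s} {s₁} {s₂} s₂≽s₁ s₁≽s , Eq⇒DefinedIn b t λ {s₃} s₃≽s₂ →
          Eq-trans τ (t~u (≽-trans {s₁} {s₂} {s₃} s₃≽s₂ s₂≽s₁))
            (Eq-trans τ (DefinedIn⇒Eq u def s₃≽s₂) (Eq-sym τ (t~u s₂≽s₁)))

  -- By soundness the two terms agree in every state, so locality applies with no extension at all.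
  Comp-⟶ : ∀ {t u} → t ⟶ u → Comp τ u → Comp τ t
  Comp-⟶ {τ} {t} {u} r cu =
    Comp-local τ t λ s → s , ≽-refl s , u , cu , λ _ → ⟶-sound r λ ()

  -- Beyond a state where `u` is defined its value `d` is fixed, so `t · u` agrees there with
  -- `t · canonical b d`. The value varies with the starting state, and locality joins these cases.
  Comp-⇒ : (b : Atomic σ) (t : 𝒯class [] (σ ⇒ τ)) →
           (∀ d → Comp τ (t · canonical b d)) → Comp (σ ⇒ τ) t
  Comp-⇒ {σ} {τ} b t h u cu = Comp-local τ (t · u) λ s →
    let s′ , s′≽s , def = Comp⇒Dense b cu s
        d = ⟦ u ⟧ˢ s′
    in  s′ , s′≽s , t · canonical b d , h d , λ s″≽s′ →
          ⟦⟧-cong t (λ ()) _ _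
            (Eq-trans σ (DefinedIn⇒Eq u def s″≽s′) (Eq-sym σ (⟦canonical⟧ b)))

  -- Computability of the constants of `𝒯`

  Comp-canonical : (b : Atomic τ) (d : Val τ) → Comp τ (canonical b d)
  Comp-canonical {τ} b d = Dense⇒Comp b λ s →
    s , ≽-refl s ,
    Eq⇒DefinedIn b (canonical b d) λ _ → Eq-trans τ (⟦canonical⟧ b) (Eq-sym τ (⟦canonical⟧ b))

  Comp-con : (c : Const τ) → Comp τ (con c)
  Comp-con zeroᶜ    = Comp-canonical N 0
  Comp-con sucᶜ     = Comp-⇒ N (con sucᶜ) λ n → Comp-canonical N (suc n)
  Comp-con trueᶜ    = Comp-canonical Bool true
  Comp-con falseᶜ   = Comp-canonical Bool false
  Comp-con (ifᶜ τ)  = Comp-⇒ Bool (con (ifᶜ τ)) λ where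
    true  t ct u cu → Comp-⟶ (if-true t u) ct
    false t ct u cu → Comp-⟶ (if-false t u) cu
  -- Once the recursion argument is a numeral, ordinary induction on it suffices.
  Comp-con (recᶜ τ) u cu v cv = Comp-⇒ N (con (recᶜ τ) · u · v) go
    where
    go : ∀ n → Comp τ (con (recᶜ τ) · u · v · numeral n)
    go zero    = Comp-⟶ (rec-zero u v) cu
    go (suc n) = Comp-⟶ (rec-suc u v (numeral n)) (cv (numeral n) (Comp-canonical N n) _ (go n))
  Comp-con (updᶜ V) = Comp-canonical U V
  Comp-con minᶜ     = Comp-⇒ U (con minᶜ) λ V →
    Comp-⟶ (δ-min V) (Comp-canonical N (minimum V))
  Comp-con getᶜ     =
    Comp-⇒ U (con getᶜ) λ V →
    Comp-⇒ N (con getᶜ · con (updᶜ V)) λ a →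
    Comp-⇒ N (con getᶜ · con (updᶜ V) · numeral a) λ n →
    Comp-⇒ N (con getᶜ · con (updᶜ V) · numeral a · numeral n) λ l →
    Comp-⟶ (δ-get V a n l) (Comp-canonical N (getU V a n l))
  Comp-con mkupdᶜ   =
    Comp-⇒ N (con mkupdᶜ) λ a →
    Comp-⇒ N (con mkupdᶜ · numeral a) λ n →
    Comp-⇒ N (con mkupdᶜ · numeral a · numeral n) λ m →
    Comp-⟶ (δ-mkupd a n m) (Comp-canonical U (singleton a n m))
  Comp-con ∪ᶜ       =
    Comp-⇒ U (con ∪ᶜ) λ V →
    Comp-⇒ U (con ∪ᶜ · con (updᶜ V)) λ W →
    Comp-⟶ (δ-∪ V W) (Comp-canonical U (V ∪ W))

  -- Enlarging the domain of a state, and the constants `Φ`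

  dm-dense : ∀ s A (ns : Vec ℕ (suc (extra A))) →
             ∃[ s′ ] s′ ≽ s × dm s′ (index A , ⟨ ns ⟩)
  dm-dense s A ns with em {dm s (index A , ⟨ ns ⟩)}
  ... | yes d = s , ≽-refl s , d
  ... | no ¬d with em {∃[ y ] Holds A ns (numeral y)}
  -- Without a witness the implication in `dm` holds vacuously, against `¬d`.
  ...   | no ∄y = contradiction (A , ns , refl , refl , λ _ ∃y → contradiction ∃y ∄y) ¬d
  -- The witness `y` is stored at the one point in question; the order is respected because that
  -- point lies outside the domain of `s`.
  ...   | yes (y , hy) =
    s′ , fun-≽ {s} {s′} unchanged , A , ns , refl , refl , λ _ _ → Holds-resp A ns hit hy
    where
    i = index A
    c = ⟨ ns ⟩
    m = value c
    s′ = override s i m y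

    unchanged : ∀ {j u} → dm s (j , u) → fun s j (value u) ≡ fun s′ j (value u)
    unchanged {j} {u} d = sym (trans (fun-override s i m y j (value u))
      (getU-miss i m y _ λ eq → miss d (cong proj₁ eq) (cong proj₂ eq)))
      where
      miss : dm s (j , u) → j ≡ i → value u ≡ m → ⊥
      -- Injectivity of `assoc` and of the coding shows that a domain point hit by the override
      -- would come from the same `A` and `ns`, which `¬d` excludes.
      miss (B , ks , refl , refl , h) j≡i u≡m with Bijection.injective assoc j≡i
      ... | refl with injective ks ns (Eq⇒≈ N ⟨ ks ⟩ ⟨ ns ⟩ u≡m)
      ...   | refl = ¬d (B , ks , refl , refl , h)

    hit : value (numeral {⊥} {[]} y) ≡ value (s′ at i · c)
    hit = begin
      value (numeral {⊥} {[]} y)                ≡⟨ ⟦numeral⟧ y ⟩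
      y                                         ≡⟨ getU-hit i m y (fun s i m) ⟨
      getU (singleton i m y) i m (fun s i m)    ≡⟨ fun-override s i m y i m ⟨
      fun s′ i m                                ≡⟨ ⟦at⟧ s′ i c ⟨
      value (s′ at i · c)                       ∎
      where open ≡-Reasoning

  -- Surjectivity of `assoc` and of the coding presents every argument pair by some `A` and `ns`.
  -- Once this point is in the domain of a state, all extensions share its value.
  Comp-Φ : ∀ i → Comp (N ⇒ N) (Φ i)
  Comp-Φ i = Comp-⇒ N (Φ i) λ m s →
    let A , A↦i = Bijection.surjective assoc i in dense m s A (A↦i refl)
    where
    dense : ∀ m s A → index A ≡ i → ∃[ s′ ] s′ ≽ s × DefinedIn (Φ i · numeral m) s′
    dense m s A refl with surjective {extra A} m
    ... | ns , ⟨ns⟩≈m with dm-dense s A ns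
    ...   | s′ , s′≽s , d = s′ , s′≽s , Eq⇒DefinedIn N (Φ i · numeral m) λ {s″} s″≽s′ → begin
      fun s″ i (⟦ numeral m ⟧ˢ s″)  ≡⟨ cong (fun s″ i) (value-m s″) ⟩
      fun s″ i (value c)            ≡⟨ ≽-fun {s′} {s″} s″≽s′ d ⟨
      fun s′ i (value c)            ≡⟨ cong (fun s′ i) (value-m s′) ⟨
      fun s′ i (⟦ numeral m ⟧ˢ s′)  ∎
      where
      open ≡-Reasoning
      c = ⟨ ns ⟩
      value-m : ∀ s → ⟦ numeral m ⟧ˢ s ≡ value c
      -- The domain contains the closed term `⟨ ns ⟩` and not the numeral `m`; the two are matched
      -- by value.
      value-m s = trans (⟦numeral⟧ m) (sym (trans (≈⇒Eq ⟨ns⟩≈m) (⟦numeral⟧ m)))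

  -- Closure of computability under substitution

  Comp-subst : (v : 𝒯class Δ τ) (θ : Sub ℕ Δ []) → (∀ {σ} (x : σ ∈ Δ) → Comp σ (θ x)) →
               Comp τ (subst θ v)
  Comp-subst (var x)    θ cθ = cθ x
  Comp-subst (con c)    θ cθ = Comp-con c
  Comp-subst (Φ i)      θ cθ = Comp-Φ i
  -- Computability is carried back along β from the contractum, which is the body under the
  -- substitution extended by `u`.
  Comp-subst (ƛ {τ = τ} v) θ cθ u cu = Comp-⟶ (β _ u)
    (transport (Comp τ) (sym (exts-[]₀ θ v u))
      (Comp-subst v (u ∷ˢ θ) λ { (here refl) → cu ; (there x) → cθ x }))
  Comp-subst (v · w)    θ cθ = Comp-subst v θ cθ _ (Comp-subst w θ cθ)
  Comp-subst (pair v w) θ cθ =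
    Comp-⟶ (β-π₀ _ _) (Comp-subst v θ cθ) , Comp-⟶ (β-π₁ _ _) (Comp-subst w θ cθ)
  Comp-subst (π₀ v)     θ cθ = proj₁ (Comp-subst v θ cθ)
  Comp-subst (π₁ v)     θ cθ = proj₂ (Comp-subst v θ cθ)

mainTheorem4 : ExcludedMiddle 0ℓ →
    (assoc : ArithFormula ⤖ ℕ) (coding : Coding) (Γ : List ArithFormula) →
    let open Computability assoc coding Γ in
    ∀ {Δ τ} (v : 𝒯class Δ τ) (t : Sub ℕ Δ []) →
    (∀ {σ} (x : σ ∈ Δ) → Comp σ (t x)) →
    Comp τ (subst t v)
mainTheorem4 em assoc coding Γ = Computable.Comp-subst em assoc coding Γ
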